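{- Let $G$ be a triangle-critical claw-free graph with $\chi(G) = 12$. Then $G$ is a complete graph (i.e. $G \cong K_{12}$).
   Context: All graphs are finite and simple. $\chi(G)$ denotes the chromatic number. A graph is claw-free if it has no induced subgraph isomorphic to $K_{1,3}$. For $\ell \geq 2$, a graph $G$ is called $K_{\ell}$-critical if (i) $G$ contains $K_{\ell}$ as a subgraph; (ii) $G$ is critical, i.e. removing any vertex reduces the chromatic number of $G$ by one; (iii) removing the vertex set of any copy of $K_{\ell}$ in $G$ reduces the chromatic number of $G$ by exactly $\ell$. A graph is triangle-critical if it is $K_3$-critical. -}

module Defs where

open import Data.Bool using (Bool; true; false; not; _∧_; T)
open import Data.Nat using (ℕ; _<_; _∸_)
open import Data.Fin using (Fin; _≟_)
open import Data.Product using (Σ; _×_; ∃-syntax)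
open import Relation.Nullary using (¬_; does)
open import Relation.Binary.PropositionalEquality using (_≡_; _≢_)

record Graph (n : ℕ) : Set where
  field
    adj   : Fin n → Fin n → Bool
    sym   : ∀ u v → adj u v ≡ adj v u
    irrefl : ∀ v → adj v v ≡ false
open Graph public

Adj : ∀ {n} → Graph n → Fin n → Fin n → Set
Adj G u v = adj G u v ≡ true

VSet : ℕ → Set
VSet n = Fin n → Bool

allV : ∀ {n} → VSet n
allV _ = true

_─_ : ∀ {n} → VSet n → Fin n → VSet n
(S ─ x) v = S v ∧ not (does (v ≟ x))

ColourableOn : ∀ {n} → Graph n → VSet n → ℕ → Set
ColourableOn {n} G S k =
  Σ ((v : Fin n) → T (S v) → Fin k) λ c →
    ∀ u v (su : T (S u)) (sv : T (S v)) → Adj G u v → c u su ≢ c v sv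

ChiOn : ∀ {n} → Graph n → VSet n → ℕ → Set
ChiOn G S k = ColourableOn G S k × (∀ m → m < k → ¬ ColourableOn G S m)

Chi : ∀ {n} → Graph n → ℕ → Set
Chi G k = ChiOn G allV k

IsTriangle : ∀ {n} → Graph n → Fin n → Fin n → Fin n → Set
IsTriangle G a b c = Adj G a b × Adj G b c × Adj G a c

Critical : ∀ {n} → Graph n → Set
Critical {n} G = ∀ k → Chi G k → ∀ (v : Fin n) → ChiOn G (allV ─ v) (k ∸ 1)

TriangleCritical : ∀ {n} → Graph n → Set
TriangleCritical {n} G =
  (∃[ a ] ∃[ b ] ∃[ c ] IsTriangle G a b c)
  × Critical G
  × (∀ k → Chi G k → ∀ a b c → IsTriangle G a b c →
       ChiOn G (((allV ─ a) ─ b) ─ c) (k ∸ 3))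

ClawFree : ∀ {n} → Graph n → Set
ClawFree {n} G = ∀ (a b c d : Fin n) →
  b ≢ c → b ≢ d → c ≢ d →
  Adj G a b → Adj G a c → Adj G a d →
  ¬ (adj G b c ≡ false × adj G b d ≡ false × adj G c d ≡ false)

Complete : ∀ {n} → Graph n → Set
Complete {n} G = ∀ (u v : Fin n) → u ≢ v → Adj G u v

{-# OPTIONS --safe #-}
module Submission where

-- Suppose u₀ and v₀ are distinct and non-adjacent.  In a 9-colouring of G minus a triangle every
-- class contains a common neighbour of the triangle, and by claw-freeness it contains at most two
-- neighbours of any given vertex.  Every edge lies in a triangle, and some triangle avoids v₀ and its
-- neighbours.  Colouring G without that triangle, only the 8 classes not containing v₀ meet N(v₀),
-- so 11 ≤ d ≤ 16 for d = deg v₀.  Let F be the non-adjacency relation on N(v₀), which is triangle-free.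
-- Comparing with the colouring of G - {v₀, y, z} for adjacent y, z in N(v₀) gives
-- |F(y) ∪ F(z)| ≤ d - 11, shows that every F-degree is 0 or at least 3, and bounds by 20 - d the number
-- of F-isolated vertices.  Since there is no 12-clique, the positive F-degrees are at most d - 12.
-- Counting the pairs (z , x) with x in F(y) ∩ F(z), for y of maximum F-degree, contradicts these bounds.

open import Defs
open import Algebra.Properties.CommutativeMonoid.Sum using (sum; ∑-distrib-+; ∑-comm)
open import Data.Bool using (T; true)
open import Data.Bool.Properties using (T-∧; ¬-not)
import Data.Bool.Properties as Bool
open import Data.Empty using (⊥; ⊥-elim)
open import Data.Fin using (Fin; zero; suc; _≟_; join; splitAt)
open import Data.Fin.Properties using (any?; splitAt-join; injective⇒≤; suc-injective)
open import Data.Nat hiding (_≟_)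
open import Data.Nat.Properties hiding (_≟_; suc-injective)
open import Data.Nat.Solver using (module +-*-Solver)
open import Data.Product using (∃; ∃-syntax; _×_; _,_; proj₁; proj₂)
open import Data.Sum using (_⊎_; inj₁; inj₂; [_,_]′)
open import Data.Unit using (⊤; tt)
open import Function using (_∘_; Equivalence)
open import Relation.Nullary using (Dec; yes; no; ¬_; contradiction)
open import Relation.Nullary.Decidable using (_×-dec_; _⊎-dec_; ¬?; T?; decidable-stable)
open import Relation.Unary using (Decidable; _⊆_)
open import Relation.Binary.PropositionalEquality renaming (sym to ≡-sym) hiding ([_])

-- Counting

∑ : ∀ {n} → (Fin n → ℕ) → ℕ
∑ = sum +-0-commutativeMonoid

∑-mono : ∀ {n} {f g : Fin n → ℕ} → (∀ x → f x ≤ g x) → ∑ f ≤ ∑ g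
∑-mono {zero}  f≤g = z≤n
∑-mono {suc n} f≤g = +-mono-≤ (f≤g zero) (∑-mono (f≤g ∘ suc))

∑-*ʳ : ∀ {n} (f : Fin n → ℕ) k → ∑ (λ x → f x * k) ≡ ∑ f * k
∑-*ʳ {zero}  f k = refl
∑-*ʳ {suc n} f k =
  trans (cong (f zero * k +_) (∑-*ʳ (f ∘ suc) k)) (≡-sym (*-distribʳ-+ k (f zero) _))

𝟙 : {A : Set} → Dec A → ℕ
𝟙 (yes _) = 1
𝟙 (no _)  = 0

-- One point of |A| + |B| = |A ∪ B| + |A ∩ B|, relaxed so that `C` and `E` need only contain the
-- union and the intersection.
𝟙-modular : {A B C E : Set} (a? : Dec A) (b? : Dec B) (c? : Dec C) (e? : Dec E) →
  (A → C) → (B → C) → (A → B → E) → 𝟙 a? + 𝟙 b? ≤ 𝟙 c? + 𝟙 e?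
𝟙-modular (no _)  (no _)  c?       e?      ac bc abe = z≤n
𝟙-modular (no _)  (yes b) (yes _)  e?      ac bc abe = s≤s z≤n
𝟙-modular (no _)  (yes b) (no ¬c)  e?      ac bc abe = contradiction (bc b) ¬c
𝟙-modular (yes a) b?      (no ¬c)  e?      ac bc abe = contradiction (ac a) ¬c
𝟙-modular (yes a) (no _)  (yes _)  e?      ac bc abe = s≤s z≤n
𝟙-modular (yes a) (yes b) (yes _)  (yes _) ac bc abe = ≤-refl
𝟙-modular (yes a) (yes b) (yes _)  (no ¬e) ac bc abe = contradiction (abe a b) ¬e

𝟙-cover : {A B C : Set} (a? : Dec A) (b? : Dec B) (c? : Dec C) →
  (C → A ⊎ B) → 𝟙 c? ≤ 𝟙 a? + 𝟙 b?
𝟙-cover a?      b?      (no _)  cov = z≤n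
𝟙-cover (yes _) b?      (yes _) cov = s≤s z≤n
𝟙-cover (no _)  (yes _) (yes _) cov = ≤-refl
𝟙-cover (no ¬a) (no ¬b) (yes c) cov = contradiction (cov c) [ ¬a , ¬b ]′

count : ∀ {n} {P : Fin n → Set} → Decidable P → ℕ
count P? = ∑ (λ x → 𝟙 (P? x))

𝟙-none : {A : Set} (a? : Dec A) → ¬ A → 𝟙 a? ≡ 0
𝟙-none (yes a) ¬a = contradiction a ¬a
𝟙-none (no _)  ¬a = refl

𝟙-some : {A : Set} (a? : Dec A) → A → 𝟙 a? ≡ 1
𝟙-some (yes _) a = refl
𝟙-some (no ¬a) a = contradiction a ¬a

count-none : ∀ {n} {P : Fin n → Set} (P? : Decidable P) → (∀ x → ¬ P x) → count P? ≡ 0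
count-none {zero}  P? ¬P = refl
count-none {suc n} P? ¬P = cong₂ _+_ (𝟙-none (P? zero) (¬P zero)) (count-none (P? ∘ suc) (¬P ∘ suc))

count-all : ∀ {n} {P : Fin n → Set} (P? : Decidable P) → (∀ x → P x) → count P? ≡ n
count-all {zero}  P? all = refl
count-all {suc n} P? all = cong₂ _+_ (𝟙-some (P? zero) (all zero)) (count-all (P? ∘ suc) (all ∘ suc))

count-≡1 : ∀ {n} {P : Fin n → Set} (P? : Decidable P) y → P y → (∀ {x} → P x → x ≡ y) → count P? ≡ 1
count-≡1 P? zero Py uniq =
  cong₂ _+_ (𝟙-some (P? zero) Py) (count-none (P? ∘ suc) (λ x Px → contradiction (uniq Px) λ ()))
count-≡1 P? (suc y) Py uniq =
  cong₂ _+_ (𝟙-none (P? zero) (λ P0 → contradiction (uniq P0) λ ()))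
            (count-≡1 (P? ∘ suc) y Py (λ Px → suc-injective (uniq Px)))

count-≟ : ∀ {n} (y : Fin n) → count (_≟ y) ≡ 1
count-≟ y = count-≡1 (_≟ y) y refl (λ x≡y → x≡y)

module _ {n : ℕ} {A B C : Fin n → Set} (A? : Decidable A) (B? : Decidable B) (C? : Decidable C) where

  count-modular : {E : Fin n → Set} (E? : Decidable E) → A ⊆ C → B ⊆ C → (∀ {x} → A x → B x → E x) →
    count A? + count B? ≤ count C? + count E?
  count-modular E? A⊆C B⊆C A∩B⊆E = begin
    count A? + count B?
      ≡⟨ ∑-distrib-+ +-0-commutativeMonoid (λ x → 𝟙 (A? x)) (λ x → 𝟙 (B? x)) ⟨
    ∑ (λ x → 𝟙 (A? x) + 𝟙 (B? x))
      ≤⟨ ∑-mono (λ x → 𝟙-modular (A? x) (B? x) (C? x) (E? x) A⊆C B⊆C A∩B⊆E) ⟩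
    ∑ (λ x → 𝟙 (C? x) + 𝟙 (E? x))
      ≡⟨ ∑-distrib-+ +-0-commutativeMonoid (λ x → 𝟙 (C? x)) (λ x → 𝟙 (E? x)) ⟩
    count C? + count E? ∎
    where open ≤-Reasoning

  count-disjoint : A ⊆ C → B ⊆ C → (∀ {x} → A x → B x → ⊥) → count A? + count B? ≤ count C?
  count-disjoint A⊆C B⊆C disj = begin
    count A? + count B?     ≤⟨ count-modular none? A⊆C B⊆C disj ⟩
    count C? + count none?  ≡⟨ cong (count C? +_) (count-none none? (λ _ ())) ⟩
    count C? + 0            ≡⟨ +-identityʳ _ ⟩
    count C?                ∎
    where
    open ≤-Reasoning
    none? : Decidable {A = Fin n} (λ _ → ⊥)
    none? _ = no λ ()

  count-cover : (∀ {x} → C x → A x ⊎ B x) → count C? ≤ count A? + count B?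
  count-cover cov = begin
    count C?
      ≤⟨ ∑-mono (λ x → 𝟙-cover (A? x) (B? x) (C? x) cov) ⟩
    ∑ (λ x → 𝟙 (A? x) + 𝟙 (B? x))
      ≡⟨ ∑-distrib-+ +-0-commutativeMonoid (λ x → 𝟙 (A? x)) (λ x → 𝟙 (B? x)) ⟩
    count A? + count B? ∎
    where open ≤-Reasoning

count-⊆ : ∀ {n} {P Q : Fin n → Set} (P? : Decidable P) (Q? : Decidable Q) → P ⊆ Q → count P? ≤ count Q?
count-⊆ P? Q? P⊆Q = ≤-trans (m≤m+n (count P?) _)
  (count-disjoint P? (λ _ → no λ ()) Q? P⊆Q ⊥-elim (λ _ ff → ff))

module _ {n : ℕ} {P : Fin n → Set} (P? : Decidable P) where

  infixl 20 _without_
  _without_ : ∀ y → Decidable (λ x → P x × x ≢ y)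
  _without_ y x = P? x ×-dec ¬? (x ≟ y)

  count-without-≥ : ∀ y → count P? ≤ count (_without_ y) + 1
  count-without-≥ y = subst (λ k → count P? ≤ count (_without_ y) + k) (count-≟ y)
    (count-cover (_without_ y) (_≟ y) P? split)
    where
    split : ∀ {x} → P x → (P x × x ≢ y) ⊎ x ≡ y
    split {x} Px with x ≟ y
    ... | yes x≡y = inj₂ x≡y
    ... | no x≢y  = inj₁ (Px , x≢y)

  count-without-< : ∀ {y} → P y → count (_without_ y) + 1 ≤ count P?
  count-without-< {y} Py = subst (λ k → count (_without_ y) + k ≤ count P?) (count-≟ y)
    (count-disjoint (_without_ y) (_≟ y) P? proj₁ (λ { refl → Py }) (λ (_ , x≢y) x≡y → x≢y x≡y))

  count-pos : ∀ {y} → P y → 1 ≤ count P?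
  count-pos Py = ≤-trans (m≤n+m 1 _) (count-without-< Py)

  count-witness : 1 ≤ count P? → ∃ P
  count-witness 1≤ with any? P?
  ... | yes ∃P = ∃P
  ... | no ¬∃P = contradiction (subst (1 ≤_) (count-none P? (λ x Px → ¬∃P (x , Px))) 1≤) λ ()

  count-≤1 : (∀ {x y} → P x → P y → x ≡ y) → count P? ≤ 1
  count-≤1 uniq with any? P?
  ... | yes (y , Py) = ≤-reflexive (count-≡1 P? y Py (λ Px → uniq Px Py))
  ... | no ¬∃P       = ≤-trans (≤-reflexive (count-none P? (λ x Px → ¬∃P (x , Px)))) z≤n

count-≤2 : ∀ {n} {P : Fin n → Set} (P? : Decidable P) →
  (∀ {x y z} → P x → P y → P z → x ≢ y → x ≢ z → y ≢ z → ⊥) → count P? ≤ 2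
count-≤2 P? no3 with any? P?
... | no ¬∃P       = ≤-trans (≤-reflexive (count-none P? (λ x Px → ¬∃P (x , Px)))) z≤n
... | yes (z , Pz) = ≤-trans (count-without-≥ P? z) (+-monoˡ-≤ 1 (count-≤1 (P? without z) uniq))
  where
  uniq : ∀ {x y} → _ × x ≢ z → _ × y ≢ z → x ≡ y
  uniq {x} {y} (Px , x≢z) (Py , y≢z) = decidable-stable (x ≟ y) (λ x≢y → no3 Px Py Pz x≢y x≢z y≢z)

count-≥3 : ∀ {n} {P : Fin n → Set} (P? : Decidable P) {x y z} →
  P x → P y → P z → x ≢ y → x ≢ z → y ≢ z → 3 ≤ count P?
count-≥3 P? {x} {y} {z} Px Py Pz x≢y x≢z y≢z = begin
  3
    ≤⟨ +-monoˡ-≤ 1 (+-monoˡ-≤ 1 (count-pos (P? without z without y) ((Px , x≢z) , x≢y))) ⟩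
  count (P? without z without y) + 1 + 1
    ≤⟨ +-monoˡ-≤ 1 (count-without-< (P? without z) (Py , y≢z)) ⟩
  count (P? without z) + 1
    ≤⟨ count-without-< P? Pz ⟩
  count P?                              ∎
  where open ≤-Reasoning

-- Both sides bound the number of incidences `R`: rows outside `Q` are bounded below by 0, and
-- columns outside `A` are empty.
double-count : ∀ {m n} {Q : Fin m → Set} {A : Fin n → Set} {R : Fin m → Fin n → Set}
  (Q? : Decidable Q) (A? : Decidable A) (R? : ∀ z → Decidable (R z)) {t Δ} →
  (∀ z → Q z → t ≤ count (R? z)) → (∀ x → A x → count (λ z → R? z x) ≤ Δ) →
  (∀ {z x} → R z x → A x) → count Q? * t ≤ count A? * Δ
double-count Q? A? R? {t} {Δ} lower upper R⊆A = begin
  count Q? * t                             ≡⟨ ∑-*ʳ (λ z → 𝟙 (Q? z)) t ⟨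
  ∑ (λ z → 𝟙 (Q? z) * t)                   ≤⟨ ∑-mono (λ z → low (Q? z) (lower z)) ⟩
  ∑ (λ z → ∑ (λ x → 𝟙 (R? z x)))           ≡⟨ ∑-comm +-0-commutativeMonoid (λ z x → 𝟙 (R? z x)) ⟩
  ∑ (λ x → ∑ (λ z → 𝟙 (R? z x)))           ≤⟨ ∑-mono (λ x → upp (A? x) (upper x)
                                                (λ ¬Ax → count-none (λ z → R? z x) (λ z r → ¬Ax (R⊆A r)))) ⟩
  ∑ (λ x → 𝟙 (A? x) * Δ)                   ≡⟨ ∑-*ʳ (λ x → 𝟙 (A? x)) Δ ⟩
  count A? * Δ                             ∎
  where
  open ≤-Reasoning
  low : ∀ {B : Set} {s} (b? : Dec B) → (B → t ≤ s) → 𝟙 b? * t ≤ s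
  low (yes b) le = ≤-trans (≤-reflexive (+-identityʳ t)) (le b)
  low (no _)  le = z≤n
  upp : ∀ {B : Set} {s} (b? : Dec B) → (B → s ≤ Δ) → (¬ B → s ≡ 0) → s ≤ 𝟙 b? * Δ
  upp (yes b) le ze = ≤-trans (le b) (≤-reflexive (≡-sym (+-identityʳ Δ)))
  upp (no ¬b) le ze = ≤-reflexive (ze ¬b)

module _ {n k : ℕ} (c : Fin n → Fin k) {P : Fin n → Set} (P? : Decidable P) where

  class? : ∀ j → Decidable (λ x → P x × c x ≡ j)
  class? j x = P? x ×-dec (c x ≟ j)

  -- Double counting of vertices against colours: each vertex of `P` has a colour, and only colours
  -- in `A` occur.
  count-by-classes : {A : Fin k → Set} (A? : Decidable A) {b : ℕ} → (∀ {x} → P x → A (c x)) →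
    (∀ j → count (class? j) ≤ b) → count P? ≤ count A? * b
  count-by-classes A? P→A small = subst (_≤ _) (*-identityʳ (count P?))
    (double-count P? A? (λ x j → class? j x)
      (λ x Px → count-pos (λ j → class? j x) (Px , refl))
      (λ j _ → small j)
      (λ { (Px , refl) → P→A Px }))

  count-≥classes : (∀ j → ∃[ x ] P x × c x ≡ j) → k ≤ count P?
  count-≥classes hit = begin
    k                        ≡⟨ count-all (λ (_ : Fin k) → yes tt) (λ _ → tt) ⟨
    count (λ (_ : Fin k) → yes tt)     ≡⟨ *-identityʳ _ ⟨
    count (λ (_ : Fin k) → yes tt) * 1 ≤⟨ double-count (λ _ → yes tt) P? class?
                                   (λ j _ → count-pos (class? j) (proj₂ (hit j)))
                                   (λ x Px → count-≤1 (λ j → class? j x) (λ { (_ , refl) (_ , refl) → refl }))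
                                   proj₁ ⟩
    count P? * 1             ≡⟨ *-identityʳ _ ⟩
    count P?                 ∎
    where open ≤-Reasoning

-- Colourings of G minus a vertex or a triangle

module _ {n : ℕ} (G : Graph n) where

  private
    _~_ : Fin n → Fin n → Set
    _~_ = Adj G

  adj? : ∀ u → Decidable (u ~_)
  adj? u v = adj G u v Bool.≟ true

  ~-sym : ∀ {u v} → u ~ v → v ~ u
  ~-sym {u} {v} uv = trans (sym G v u) uv

  ~-irrefl : ∀ {u v} → u ~ v → u ≢ v
  ~-irrefl {u} uu refl = contradiction (trans (≡-sym uu) (irrefl G u)) λ ()

  ─-intro : ∀ {S : VSet n} {a x} → T (S x) → x ≢ a → T ((S ─ a) x)
  ─-intro {S} {a} {x} Sx x≢a with x ≟ a
  ... | yes x≡a = contradiction x≡a x≢a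
  ... | no _    = Equivalence.from T-∧ (Sx , tt)

  -- Removes the membership proofs from a colouring. Vertices outside `S` get the arbitrary colour
  -- `zero`, so at least one colour is assumed.
  totalise : ∀ {S k} → ColourableOn G S (suc k) →
    ∃[ c ] (∀ {u v} → T (S u) → T (S v) → u ~ v → c u ≢ c v)
  totalise {S} {k} (c , proper) = c′ , λ {u} {v} → proper′ u v
    where
    paint : ∀ v → Dec (T (S v)) → Fin (suc k)
    paint v (yes s) = c v s
    paint v (no _)  = zero
    c′ : Fin n → Fin (suc k)
    c′ v = paint v (T? (S v))
    proper′ : ∀ u v → T (S u) → T (S v) → u ~ v → c′ u ≢ c′ v
    proper′ u v su sv with T? (S u) | T? (S v)
    ... | yes su′ | yes sv′ = proper u v su′ sv′
    ... | no ¬su  | _       = contradiction su ¬su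
    ... | yes _   | no ¬sv  = contradiction sv ¬sv

  record VertexColouring (k : ℕ) (v : Fin n) : Set where
    field
      colour : Fin n → Fin k
      proper : ∀ {x y} → x ≢ v → y ≢ v → x ~ y → colour x ≢ colour y
      hit    : ∀ j → ∃[ w ] v ~ w × colour w ≡ j

  -- A colour missing from the neighbourhood of `v` could be given to `v`, extending the colouring
  -- to all of `G`.
  vertex-colouring : ∀ {k v} → ¬ ColourableOn G allV (suc k) → ColourableOn G (allV ─ v) (suc k) →
    VertexColouring (suc k) v
  vertex-colouring {k} {v} ¬col col = record { colour = c ; proper = c-proper ; hit = hits }
    where
    c : Fin n → Fin (suc k)
    c = proj₁ (totalise col)
    c-proper : ∀ {x y} → x ≢ v → y ≢ v → x ~ y → c x ≢ c y
    c-proper x≢v y≢v = proj₂ (totalise col) (─-intro {allV} tt x≢v) (─-intro {allV} tt y≢v)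
    hits : ∀ j → ∃[ w ] v ~ w × c w ≡ j
    hits j with any? (λ w → adj? v w ×-dec (c w ≟ j))
    ... | yes hit = hit
    ... | no miss = contradiction ((λ x _ → paint x (x ≟ v)) , λ x y _ _ → paint-proper (x ≟ v) (y ≟ v)) ¬col
      where
      paint : ∀ x → Dec (x ≡ v) → Fin (suc k)
      paint x (yes _) = j
      paint x (no _)  = c x
      paint-proper : ∀ {x y} x? y? → x ~ y → paint x x? ≢ paint y y?
      paint-proper (yes refl) (yes refl) xy _ = ~-irrefl xy refl
      paint-proper (yes refl) (no _)     xy e = miss (_ , xy , ≡-sym e)
      paint-proper (no _)     (yes refl) xy e = miss (_ , ~-sym xy , e)
      paint-proper (no x≢v)   (no y≢v)   xy e = c-proper x≢v y≢v xy e

  record TriangleColouring (k : ℕ) (p q r : Fin n) : Set where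
    field
      colour : Fin n → Fin k
      proper : ∀ {x y} → x ≢ p × x ≢ q × x ≢ r → y ≢ p × y ≢ q × y ≢ r → x ~ y → colour x ≢ colour y
      hit    : ∀ j → ∃[ w ] (p ~ w × q ~ w × r ~ w) × colour w ≡ j

  -- If the class j held no common neighbour of p, q and r, each of its vertices could join one of
  -- three classes led by p, q and r, and two additional colours would suffice for G.
  triangle-colouring : ∀ {k p q r} → ¬ ColourableOn G allV (suc k + 2) →
    ColourableOn G (((allV ─ p) ─ q) ─ r) (suc k) → TriangleColouring (suc k) p q r
  triangle-colouring {k} {p} {q} {r} ¬col col = record { colour = c ; proper = c-proper ; hit = hits }
    where
    c : Fin n → Fin (suc k)
    c = proj₁ (totalise col)
    Off : Fin n → Set
    Off x = x ≢ p × x ≢ q × x ≢ r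
    off : ∀ {x} → Off x → T ((((allV ─ p) ─ q) ─ r) x)
    off (x≢p , x≢q , x≢r) = ─-intro {(allV ─ p) ─ q} (─-intro {allV ─ p} (─-intro {allV} tt x≢p) x≢q) x≢r
    c-proper : ∀ {x y} → Off x → Off y → x ~ y → c x ≢ c y
    c-proper x∉ y∉ = proj₂ (totalise col) (off x∉) (off y∉)
    hits : ∀ j → ∃[ w ] (p ~ w × q ~ w × r ~ w) × c w ≡ j
    hits j with any? (λ w → (adj? p w ×-dec adj? q w ×-dec adj? r w) ×-dec (c w ≟ j))
    ... | yes hit = hit
    ... | no miss = contradiction (recolouring , recolouring-proper) ¬col
      where
      Palette : Set
      Palette = Fin (suc k) ⊎ Fin 2
      Led : Fin n → Fin n → Set
      Led t x = x ≡ t ⊎ (Off x × c x ≡ j × ¬ t ~ x)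
      led-independent : ∀ {t x y} → Led t x → Led t y → ¬ x ~ y
      led-independent (inj₁ refl)             (inj₁ refl)           xy = ~-irrefl xy refl
      led-independent (inj₁ refl)             (inj₂ (_ , _ , ¬ty))  xy = ¬ty xy
      led-independent (inj₂ (_ , _ , ¬tx))    (inj₁ refl)           xy = ¬tx (~-sym xy)
      led-independent (inj₂ (x∉ , cx , _))    (inj₂ (y∉ , cy , _))  xy = c-proper x∉ y∉ xy (trans cx (≡-sym cy))
      -- The class led by `p` takes over the colour `j`, vacated by the old class; those led by `q`
      -- and `r` use the two additional colours.
      data Painted (x : Fin n) : Palette → Set where
        old   : ∀ {i} → Off x → i ≢ j → c x ≡ i → Painted x (inj₁ i)
        led-p : ∀ {i} → Led p x → i ≡ j → Painted x (inj₁ i)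
        led-q : Led q x → Painted x (inj₂ zero)
        led-r : Led r x → Painted x (inj₂ (suc zero))
      painted-independent : ∀ {x y i} → Painted x i → Painted y i → ¬ x ~ y
      painted-independent (old x∉ _ cx)  (old y∉ _ cy)  xy = c-proper x∉ y∉ xy (trans cx (≡-sym cy))
      painted-independent (old _ i≢j _)  (led-p _ i≡j)  xy = i≢j i≡j
      painted-independent (led-p _ i≡j)  (old _ i≢j _)  xy = i≢j i≡j
      painted-independent (led-p lx _)   (led-p ly _)   xy = led-independent lx ly xy
      painted-independent (led-q lx)     (led-q ly)     xy = led-independent lx ly xy
      painted-independent (led-r lx)     (led-r ly)     xy = led-independent lx ly xy
      paint : ∀ x → ∃ (Painted x)
      paint x with x ≟ p | x ≟ q | x ≟ r
      ... | yes x≡p | _       | _       = _ , led-p (inj₁ x≡p) refl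
      ... | no _    | yes x≡q | _       = _ , led-q (inj₁ x≡q)
      ... | no _    | no _    | yes x≡r = _ , led-r (inj₁ x≡r)
      ... | no x≢p  | no x≢q  | no x≢r with c x ≟ j
      ...   | no cx≢j = _ , old (x≢p , x≢q , x≢r) cx≢j refl
      ...   | yes cx≡j with adj? p x | adj? q x
      ...     | no ¬px | _      = _ , led-p (inj₂ ((x≢p , x≢q , x≢r) , cx≡j , ¬px)) refl
      ...     | yes _  | no ¬qx = _ , led-q (inj₂ ((x≢p , x≢q , x≢r) , cx≡j , ¬qx))
      ...     | yes px | yes qx = _ , led-r (inj₂ ((x≢p , x≢q , x≢r) , cx≡j , λ rx → miss (x , (px , qx , rx) , cx≡j)))
      recolouring : ∀ x → T (allV x) → Fin (suc k + 2)
      recolouring x _ = join (suc k) 2 (proj₁ (paint x))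
      recolouring-proper : ∀ x y sx sy → x ~ y → recolouring x sx ≢ recolouring y sy
      recolouring-proper x y _ _ xy e =
        painted-independent (proj₂ (paint x)) (subst (Painted y) (≡-sym same) (proj₂ (paint y))) xy
        where
        same : proj₁ (paint x) ≡ proj₁ (paint y)
        same = trans (≡-sym (splitAt-join (suc k) 2 (proj₁ (paint x))))
                 (trans (cong (splitAt (suc k)) e) (splitAt-join (suc k) 2 (proj₁ (paint y))))

-- Claw-free graphs

module ClawFreeGraph {n : ℕ} (G : Graph n) (clawFree : ClawFree G) where

  private
    _~_ : Fin n → Fin n → Set
    _~_ = Adj G

  claw : ∀ {v a b c} → v ~ a → v ~ b → v ~ c → a ≢ b → a ≢ c → b ≢ c → ¬ a ~ b → ¬ a ~ c → b ~ c
  claw {v} {a} {b} {c} va vb vc a≢b a≢c b≢c ¬ab ¬ac = decidable-stable (adj? G b c) λ ¬bc →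
    clawFree v a b c a≢b a≢c b≢c va vb vc (¬-not ¬ab , ¬-not ¬ac , ¬-not ¬bc)

  -- Three vertices of one class in the neighbourhood of `v` would form a claw centred at `v`.
  colour-class-≤2 : ∀ {k v} (c : Fin n → Fin k) {P : Fin n → Set} (P? : Decidable P) → P ⊆ (v ~_) →
    (∀ {x y} → P x → P y → x ~ y → c x ≢ c y) → ∀ j → count (class? c P? j) ≤ 2
  colour-class-≤2 c {P} P? P⊆N proper j = count-≤2 (class? c P? j)
    λ (Px , cx) (Py , cy) (Pz , cz) x≢y x≢z y≢z →
      independent Py Pz cy cz
        (claw (P⊆N Px) (P⊆N Py) (P⊆N Pz) x≢y x≢z y≢z (independent Px Py cx cy) (independent Px Pz cx cz))
    where
    independent : ∀ {x y} → P x → P y → c x ≡ j → c y ≡ j → ¬ x ~ y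
    independent Px Py cx cy xy = proper Px Py xy (trans cx (≡-sym cy))

  -- The relation F of the introduction, triangle-free by claw-freeness.
  Anti : (v x y : Fin n) → Set
  Anti v x y = (v ~ x × v ~ y) × x ≢ y × ¬ x ~ y

  anti? : ∀ v x → Decidable (Anti v x)
  anti? v x y = (adj? G v x ×-dec adj? G v y) ×-dec ¬? (x ≟ y) ×-dec ¬? (adj? G x y)

  anti-sym : ∀ {v x y} → Anti v x y → Anti v y x
  anti-sym ((vx , vy) , x≢y , ¬xy) = (vy , vx) , (λ e → x≢y (≡-sym e)) , (λ yx → ¬xy (~-sym G yx))

  ¬anti : ∀ {v x y} → v ~ x → v ~ y → x ≢ y → ¬ Anti v x y → x ~ y
  ¬anti vx vy x≢y ¬a = decidable-stable (adj? G _ _) λ ¬xy → ¬a ((vx , vy) , x≢y , ¬xy)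

  Active : (v x : Fin n) → Set
  Active v x = ∃ (Anti v x)

  active? : ∀ v → Decidable (Active v)
  active? v x = any? (anti? v x)

  active-adj : ∀ {v x} → Active v x → v ~ x
  active-adj (_ , (vx , _) , _) = vx

  Isolated : (v x : Fin n) → Set
  Isolated v x = v ~ x × ¬ Active v x

  isolated? : ∀ v → Decidable (Isolated v)
  isolated? v x = adj? G v x ×-dec ¬? (active? v x)

  isolated-or-active : ∀ {v x} → v ~ x → Isolated v x ⊎ Active v x
  isolated-or-active {v} {x} vx with active? v x
  ... | yes act = inj₂ act
  ... | no ¬act = inj₁ (vx , ¬act)

  deg : Fin n → ℕ
  deg v = count (adj? G v)

  antideg : Fin n → Fin n → ℕ
  antideg v x = count (anti? v x)

-- Here d and r are the degrees of v in G and of y in Anti v, and q is the number of active vertices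
-- of N(v) that are neither y nor anti-adjacent to it.
too-many-incidences : ∀ {d r q} → 3 ≤ r → r + 12 ≤ d → d ≤ 16 → d + d ≤ q + r + 21 →
  (∀ {t Δ} → r + 14 ≡ d + t → r ≡ suc Δ → q * t ≤ r * Δ) → ⊥
too-many-incidences {d} {r} {q} 3≤r r+12≤d d≤16 2d≤ incidences =
  cases r 3≤r (+-cancelʳ-≤ 12 r 4 (≤-trans r+12≤d d≤16)) (m≤n⇒∃[o]m+o≡n r+12≤d) 2d≤ incidences
  where
  finish : ∀ m t b → m + b ≤ q + b → ∀ {s} → q * t ≤ s → s < m * t → ⊥
  finish m t b m≤q qt≤s s<mt = <⇒≱ s<mt (≤-trans (*-monoˡ-≤ t (+-cancelʳ-≤ b m q m≤q)) qt≤s)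
  regroup : ∀ r → q + r + 21 ≡ q + (r + 21)
  regroup r = +-assoc q r 21
  -- Only (r , d) = (3 , 15), (3 , 16) and (4 , 16) are possible. There q is at least 6, 8 and 7,
  -- and t is 2, 1 and 2, so q * t is at least 12, 8 and 14, whereas r * (r - 1) is 6, 6 and 12.
  cases : ∀ r → 3 ≤ r → r ≤ 4 → ∃[ e ] r + 12 + e ≡ d → d + d ≤ q + r + 21 →
    (∀ {t Δ} → r + 14 ≡ d + t → r ≡ suc Δ → q * t ≤ r * Δ) → ⊥
  cases 3 _ _ (0 , refl) 2d≤ inc =
    finish 6 2 24 (≤-trans 2d≤ (≤-reflexive (regroup 3))) (inc refl refl) (<ᵇ⇒< 6 12 tt)
  cases 3 _ _ (1 , refl) 2d≤ inc =
    finish 8 1 24 (≤-trans 2d≤ (≤-reflexive (regroup 3))) (inc refl refl) (<ᵇ⇒< 6 8 tt)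
  cases 4 _ _ (0 , refl) 2d≤ inc =
    finish 7 2 25 (≤-trans 2d≤ (≤-reflexive (regroup 4))) (inc refl refl) (<ᵇ⇒< 12 14 tt)
  cases 3 _ _ (suc (suc e) , refl) _ _ = contradiction (≤-trans (m≤m+n 17 e) d≤16) 1+n≰n
  cases 4 _ _ (suc e , refl) _ _ = contradiction (≤-trans (m≤m+n 17 e) d≤16) 1+n≰n
  cases 1 (s≤s ()) _ _ _ _
  cases 2 (s≤s (s≤s ())) _ _ _ _
  cases (suc (suc (suc (suc (suc _))))) _ (s≤s (s≤s (s≤s (s≤s ())))) _ _ _

-- Cliques in a non-complete graph

module NonComplete {n : ℕ} (G : Graph n) (clawFree : ClawFree G)
  (vertexColouring : ∀ v → VertexColouring G 11 v)
  (triangleColouring : ∀ {p q r} → IsTriangle G p q r → TriangleColouring G 9 p q r)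
  (u₀ v₀ : Fin n) (u₀≢v₀ : u₀ ≢ v₀) (u₀≁v₀ : ¬ Adj G u₀ v₀) where

  open ClawFreeGraph G clawFree

  private
    _~_ : Fin n → Fin n → Set
    _~_ = Adj G

  -- A clique cannot contain both `u₀` and `v₀`, so it misses some vertex z, and an 11-colouring of
  -- G - z is injective on it.
  clique-≤11 : ∀ {Q : Fin n → Set} (Q? : Decidable Q) →
    (∀ {x y} → Q x → Q y → x ≢ y → x ~ y) → count Q? ≤ 11
  clique-≤11 {Q} Q? clique = ≤-trans
    (count-by-classes colour Q? (λ _ → yes tt) (λ _ → tt)
      (λ j → count-≤1 (class? colour Q? j) λ {x} {y} (Qx , cx) (Qy , cy) →
        decidable-stable (x ≟ y) λ x≢y →
          proper (λ { refl → ¬Qz Qx }) (λ { refl → ¬Qz Qy }) (clique Qx Qy x≢y) (trans cx (≡-sym cy))))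
    (≤-reflexive (cong (_* 1) (count-all (λ (_ : Fin 11) → yes tt) (λ _ → tt))))
    where
    outsider : ∃[ z ] ¬ Q z
    outsider with Q? u₀
    ... | yes Qu₀ = v₀ , λ Qv₀ → u₀≁v₀ (clique Qu₀ Qv₀ u₀≢v₀)
    ... | no ¬Qu₀ = u₀ , ¬Qu₀
    ¬Qz : ¬ Q (proj₁ outsider)
    ¬Qz = proj₂ outsider
    open VertexColouring (vertexColouring (proj₁ outsider))

  local-clique-≤10 : ∀ {v} {Q : Fin n → Set} (Q? : Decidable Q) → Q ⊆ (v ~_) →
    (∀ {x y} → Q x → Q y → x ≢ y → x ~ y) → count Q? ≤ 10
  local-clique-≤10 {v} {Q} Q? Q⊆N clique = +-cancelʳ-≤ 1 _ _ (begin
    count Q? + 1             ≡⟨ cong (count Q? +_) (count-≟ v) ⟨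
    count Q? + count (_≟ v)  ≤⟨ count-disjoint Q? (_≟ v) Q+v? inj₁ inj₂ (λ Qx x≡v → ~-irrefl G (Q⊆N Qx) (≡-sym x≡v)) ⟩
    count Q+v?               ≤⟨ clique-≤11 Q+v? clique′ ⟩
    11                       ∎)
    where
    open ≤-Reasoning
    Q+v? : Decidable (λ x → Q x ⊎ x ≡ v)
    Q+v? x = Q? x ⊎-dec (x ≟ v)
    clique′ : ∀ {x y} → Q x ⊎ x ≡ v → Q y ⊎ y ≡ v → x ≢ y → x ~ y
    clique′ (inj₁ Qx)   (inj₁ Qy)   x≢y = clique Qx Qy x≢y
    clique′ (inj₁ Qx)   (inj₂ refl) _   = ~-sym G (Q⊆N Qx)
    clique′ (inj₂ refl) (inj₁ Qy)   _   = Q⊆N Qy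
    clique′ (inj₂ refl) (inj₂ refl) x≢y = contradiction refl x≢y

  -- Degrees and anti-neighbourhoods

  deg-≥11 : ∀ v → 11 ≤ deg v
  deg-≥11 v = count-≥classes colour (adj? G v) hit
    where open VertexColouring (vertexColouring v)

  anti-union? : ∀ v y z → Decidable (λ x → Anti v y x ⊎ Anti v z x)
  anti-union? v y z x = anti? v y x ⊎-dec anti? v z x

  -- Besides the union, N(v) contains `y`, `z` and the common neighbours of the triangle. The latter
  -- number at least 9, one for each colour, and no two of these parts meet.
  anti-union-≤ : ∀ {v y z} → IsTriangle G v y z → count (anti-union? v y z) + 11 ≤ deg v
  anti-union-≤ {v} {y} {z} △@(vy , yz , vz) = begin
    count D? + 11                  ≡⟨ +-assoc (count D?) 9 2 ⟨
    count D? + 9 + 2               ≤⟨ +-monoˡ-≤ 2 (+-monoʳ-≤ (count D?) (count-≥classes colour C? hit)) ⟩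
    count D? + count C? + 2        ≤⟨ +-monoˡ-≤ 2 (count-disjoint D? C? M? D⊆M C⊆M disj) ⟩
    count M? + 2                   ≡⟨ +-assoc (count M?) 1 1 ⟨
    count M? + 1 + 1               ≤⟨ +-monoˡ-≤ 1 (count-without-< (adj? G v without z) (vy , ~-irrefl G yz)) ⟩
    count (adj? G v without z) + 1 ≤⟨ count-without-< (adj? G v) vz ⟩
    deg v                          ∎
    where
    open ≤-Reasoning
    open TriangleColouring (triangleColouring △)
    D? = anti-union? v y z
    M? = adj? G v without z without y
    C? : Decidable (λ x → v ~ x × y ~ x × z ~ x)
    C? x = adj? G v x ×-dec adj? G y x ×-dec adj? G z x
    D⊆M : ∀ {x} → Anti v y x ⊎ Anti v z x → (v ~ x × x ≢ z) × x ≢ y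
    D⊆M (inj₁ ((_ , vx) , y≢x , ¬yx)) = (vx , λ { refl → ¬yx yz }) , λ e → y≢x (≡-sym e)
    D⊆M (inj₂ ((_ , vx) , z≢x , ¬zx)) = (vx , λ e → z≢x (≡-sym e)) , λ { refl → ¬zx (~-sym G yz) }
    C⊆M : ∀ {x} → v ~ x × y ~ x × z ~ x → (v ~ x × x ≢ z) × x ≢ y
    C⊆M (vx , yx , zx) = (vx , λ e → ~-irrefl G zx (≡-sym e)) , λ e → ~-irrefl G yx (≡-sym e)
    disj : ∀ {x} → Anti v y x ⊎ Anti v z x → v ~ x × y ~ x × z ~ x → ⊥
    disj (inj₁ (_ , _ , ¬yx)) (_ , yx , _) = ¬yx yx
    disj (inj₂ (_ , _ , ¬zx)) (_ , _ , zx) = ¬zx zx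

  -- The partner is the common neighbour of v, y and z in the colour class of w.
  partner : ∀ {v y z w} → IsTriangle G v y z → Anti v y w → w ≢ z → ∃[ p ] (y ~ p × z ~ p) × Anti v w p
  partner {v} {y} {z} {w} △ ((vy , vw) , y≢w , ¬yw) w≢z = mate (hit (colour w))
    where
    open TriangleColouring (triangleColouring △)
    mate : ∃[ p ] (v ~ p × y ~ p × z ~ p) × colour p ≡ colour w → ∃[ p ] (y ~ p × z ~ p) × Anti v w p
    -- `p` differs from `w` because only `p` is adjacent to `y`; having the same colour, the two are
    -- non-adjacent.
    mate (p , (vp , yp , zp) , same) = p , (yp , zp) , (vw , vp) , (λ { refl → ¬yw yp }) , λ wp →
      proper ((λ { refl → ~-irrefl G vw refl }) , (λ e → y≢w (≡-sym e)) , w≢z)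
             ((λ { refl → ~-irrefl G vp refl }) , (λ { refl → ~-irrefl G yp refl }) , (λ { refl → ~-irrefl G zp refl }))
             wp (≡-sym same)

  -- Otherwise claw-freeness makes N(v) - a a clique, so it has at most 10 vertices and `deg v` is
  -- at most 11. But for y, z in this clique, `a` is anti-adjacent to y, so `anti-union-≤` forces
  -- degree at least 12.
  edge-in-triangle : ∀ {v a} → v ~ a → ∃[ z ] IsTriangle G v a z
  edge-in-triangle {v} {a} va with any? (λ z → adj? G v a ×-dec adj? G a z ×-dec adj? G v z)
  ... | yes triangle = triangle
  ... | no none = contradiction deg-≤11 (<⇒≱ deg-≥12)
    where
    N-a? = adj? G v without a
    a-isolated : ∀ {x} → v ~ x → ¬ a ~ x
    a-isolated vx ax = none (_ , va , ax , vx)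
    N-a-clique : ∀ {x y} → v ~ x × x ≢ a → v ~ y × y ≢ a → x ≢ y → x ~ y
    N-a-clique (vx , x≢a) (vy , y≢a) x≢y =
      claw va vx vy (λ e → x≢a (≡-sym e)) (λ e → y≢a (≡-sym e)) x≢y (a-isolated vx) (a-isolated vy)
    deg-≤11 : deg v ≤ 11
    deg-≤11 = ≤-trans (count-without-≥ (adj? G v) a) (+-monoˡ-≤ 1 (local-clique-≤10 N-a? proj₁ N-a-clique))
    10≤ : 10 ≤ count N-a?
    10≤ = +-cancelʳ-≤ 1 _ _ (≤-trans (deg-≥11 v) (count-without-≥ (adj? G v) a))
    deg-≥12 : 12 ≤ deg v
    deg-≥12 with count-witness N-a? (≤-trans (s≤s z≤n) 10≤)
    ... | y , Ny@(vy , y≢a)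
      with count-witness (N-a? without y)
             (+-cancelʳ-≤ 1 _ _ (≤-trans (≤-trans (s≤s (s≤s z≤n)) 10≤) (count-without-≥ N-a? y)))
    ...   | z , Nz@(vz , z≢a) , z≢y =
      ≤-trans (+-monoˡ-≤ 11 (count-pos (anti-union? v y z) (inj₁ y⊥a)))
              (anti-union-≤ (vy , N-a-clique Ny Nz (λ e → z≢y (≡-sym e)) , vz))
      where
      y⊥a : Anti v y a
      y⊥a = (vy , va) , y≢a , λ ya → a-isolated vy (~-sym G ya)

  -- Applying `partner` to a triangle on the edge `v y` gives an anti-neighbour y′ of `x` adjacent
  -- to y; applying it to the triangle v, y, y′ gives a third one, adjacent to both.
  active-≥3 : ∀ {v x} → Active v x → 3 ≤ antideg v x
  active-≥3 {v} {x} (y , x⊥y@((vx , vy) , x≢y , ¬xy)) with edge-in-triangle vy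
  ... | z , △@(_ , yz , vz) with partner △ (anti-sym x⊥y) (λ { refl → ¬xy (~-sym G yz) })
  ...   | y′ , (yy′ , _) , x⊥y′@((_ , vy′) , _ , ¬xy′)
    with partner (vy , yy′ , vy′) (anti-sym x⊥y) (λ { refl → ¬xy (~-sym G yy′) })
  ...     | y″ , (yy″ , y′y″) , x⊥y″ =
    count-≥3 (anti? v x) x⊥y x⊥y′ x⊥y″ (~-irrefl G yy′) (~-irrefl G yy″) (~-irrefl G y′y″)

  antideg-≤-union : ∀ {v} y z → antideg v y ≤ count (anti-union? v y z)
  antideg-≤-union y z = count-⊆ (anti? _ y) (anti-union? _ y z) inj₁

  -- Otherwise v and its neighbours outside Anti v y would form a clique on 12 vertices.
  escape : ∀ {v y} → v ~ y → ∃[ z ] ∃[ w ] (v ~ z × ¬ Anti v y z) × ¬ Anti v y w × Anti v z w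
  escape {v} {y} vy
    with any? (λ z → any? (λ w → (adj? G v z ×-dec ¬? (anti? v y z)) ×-dec ¬? (anti? v y w) ×-dec anti? v z w))
  ... | yes found = found
  ... | no none with edge-in-triangle vy
  ...   | t , △ = contradiction deg-≤ (<⇒≱ deg->)
    where
    open ≤-Reasoning
    K? : Decidable (λ x → v ~ x × ¬ Anti v y x)
    K? x = adj? G v x ×-dec ¬? (anti? v y x)
    split : ∀ {x} → v ~ x → (v ~ x × ¬ Anti v y x) ⊎ Anti v y x
    split {x} vx with anti? v y x
    ... | yes a = inj₂ a
    ... | no ¬a = inj₁ (vx , ¬a)
    deg-≤ : deg v ≤ antideg v y + 10
    deg-≤ = begin
      deg v                   ≤⟨ count-cover K? (anti? v y) (adj? G v) split ⟩
      count K? + antideg v y  ≤⟨ +-monoˡ-≤ _ (local-clique-≤10 K? proj₁ (λ (vx , ¬x) (vz , ¬z) x≢z →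
                                   ¬anti vx vz x≢z λ x⊥z → none (_ , _ , (vx , ¬x) , ¬z , x⊥z))) ⟩
      10 + antideg v y        ≡⟨ +-comm 10 _ ⟩
      antideg v y + 10        ∎
    -- A triangle on the edge `v y` shows that at least 11 neighbours of `v` lie outside `Anti v y`.
    deg-> : antideg v y + 10 < deg v
    deg-> = begin
      suc (antideg v y + 10)              ≡⟨ +-suc (antideg v y) 10 ⟨
      antideg v y + 11                    ≤⟨ +-monoˡ-≤ 11 (antideg-≤-union y t) ⟩
      count (anti-union? v y t) + 11      ≤⟨ anti-union-≤ △ ⟩
      deg v                               ∎

  -- The `w` found by `escape` lies in the union of the two anti-neighbourhoods but not in that of
  -- `y`, which improves the 11 of `anti-union-≤` to 12.
  active-triangle : ∀ {v y} → Active v y → ∃[ z ] IsTriangle G v y z × Active v z × antideg v y + 12 ≤ deg v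
  active-triangle {v} {y} act with escape (active-adj act)
  ... | z , w , (vz , ¬y⊥z) , ¬y⊥w , z⊥w = z , △ , (w , z⊥w) , (begin
    antideg v y + 12                  ≡⟨ +-assoc (antideg v y) 1 11 ⟨
    antideg v y + 1 + 11              ≤⟨ +-monoˡ-≤ 11 bigger ⟩
    count (anti-union? v y z) + 11    ≤⟨ anti-union-≤ △ ⟩
    deg v                             ∎)
    where
    open ≤-Reasoning
    vy = active-adj act
    △ : IsTriangle G v y z
    △ = vy , ¬anti vy vz (λ { refl → ¬y⊥w z⊥w }) ¬y⊥z , vz
    bigger : antideg v y + 1 ≤ count (anti-union? v y z)
    bigger = subst (λ k → antideg v y + k ≤ count (anti-union? v y z)) (count-≟ w)
      (count-disjoint (anti? v y) (_≟ w) (anti-union? v y z) inj₁ (λ { refl → inj₂ z⊥w }) (λ { y⊥w refl → ¬y⊥w y⊥w }))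

  -- The class of an isolated vertex has no other neighbour of v; the other classes have at most two.
  isolated-bound : ∀ {v y z} → IsTriangle G v y z → Active v y → Active v z → count (isolated? v) + deg v ≤ 20
  isolated-bound {v} {y} {z} △@(vy , yz , vz) acty actz = begin
    -- Counting isolated vertices twice makes each of the nine classes contribute at most 2: one
    -- isolated vertex, or two others. The vertices `y` and `z` add the final 2.
    count I? + deg v                              ≤⟨ +-monoʳ-≤ (count I?) deg-≤ ⟩
    count I? + (count I? + (count M? + 1 + 1))    ≤⟨ +-mono-≤ I≤ (+-mono-≤ I≤ (+-monoˡ-≤ 1 (+-monoˡ-≤ 1 M≤))) ⟩
    i + (i + (a * 2 + 1 + 1))                     ≡⟨ solve 2 (λ i a → i :+ (i :+ (a :* con 2 :+ con 1 :+ con 1))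
                                                       := (i :+ a) :* con 2 :+ con 2) refl i a ⟩
    (i + a) * 2 + 2                               ≤⟨ +-monoˡ-≤ 2 (*-monoˡ-≤ 2 i+a≤9) ⟩
    20                                            ∎
    where
    open ≤-Reasoning
    open +-*-Solver
    open TriangleColouring (triangleColouring △)
    I? = isolated? v
    M? = active? v without z without y
    Used : Fin 9 → Set
    Used j = ∃[ x ] Isolated v x × colour x ≡ j
    used? : Decidable Used
    used? j = any? (class? colour I? j)
    unused? : Decidable (λ j → ¬ Used j)
    unused? j = ¬? (used? j)
    i = count used?
    a = count unused?
    off-I : ∀ {x} → Isolated v x → x ≢ v × x ≢ y × x ≢ z
    off-I (vx , ¬act) = (λ { refl → ~-irrefl G vx refl }) , (λ { refl → ¬act acty }) , (λ { refl → ¬act actz })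
    off-M : ∀ {x} → (Active v x × x ≢ z) × x ≢ y → x ≢ v × x ≢ y × x ≢ z
    off-M ((act , x≢z) , x≢y) = (λ { refl → ~-irrefl G (active-adj act) refl }) , x≢y , x≢z
    joined : ∀ {x w} → Isolated v x → v ~ w → x ≢ w → x ~ w
    joined (vx , ¬act) vw x≢w = ¬anti vx vw x≢w λ x⊥w → ¬act (_ , x⊥w)
    I≤ : count I? ≤ i
    I≤ = subst (count I? ≤_) (*-identityʳ i) (count-by-classes colour I? used? (λ Ix → _ , Ix , refl)
      λ j → count-≤1 (class? colour I? j) λ {x} {w} (Ix , cx) (Iw , cw) → decidable-stable (x ≟ w) λ x≢w →
        proper (off-I Ix) (off-I Iw) (joined Ix (proj₁ Iw) x≢w) (trans cx (≡-sym cw)))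
    M≤ : count M? ≤ a * 2
    M≤ = count-by-classes colour M? unused?
      (λ { {w} Mw@((act , _) , _) (x , Ix , same) →
           proper (off-I Ix) (off-M Mw) (joined Ix (active-adj act) (λ { refl → proj₂ Ix act })) same })
      (colour-class-≤2 colour M? (λ ((act , _) , _) → active-adj act) (λ Px Pw → proper (off-M Px) (off-M Pw)))
    i+a≤9 : i + a ≤ 9
    i+a≤9 = subst (i + a ≤_) (count-all (λ _ → yes tt) (λ _ → tt))
      (count-disjoint used? unused? (λ _ → yes tt) (λ _ → tt) (λ _ → tt) (λ u ¬u → ¬u u))
    deg-≤ : deg v ≤ count I? + (count M? + 1 + 1)
    deg-≤ = begin
      deg v                                        ≤⟨ count-cover I? (active? v) (adj? G v) isolated-or-active ⟩
      count I? + count (active? v)                 ≤⟨ +-monoʳ-≤ (count I?) (count-without-≥ (active? v) z) ⟩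
      count I? + (count (active? v without z) + 1) ≤⟨ +-monoʳ-≤ (count I?) (+-monoˡ-≤ 1
                                                        (count-without-≥ (active? v without z) y)) ⟩
      count I? + (count M? + 1 + 1)                ∎

  -- The upper bound on the degree of v₀

  triangle-far-from-v₀ : ∃[ a ] ∃[ w ] IsTriangle G u₀ a w × (a ≢ v₀ × ¬ v₀ ~ a) × (w ≢ v₀ × ¬ v₀ ~ w)
  triangle-far-from-v₀
    with VertexColouring.hit (vertexColouring u₀) (VertexColouring.colour (vertexColouring u₀) v₀)
  -- `a` shares the colour of `v₀` and so is not adjacent to it. The third vertex `t` may be
  -- adjacent to `v₀`; it is replaced by a common neighbour `w` with the colour of `v₀` in the
  -- colouring without u₀, a, t.
  ... | a , u₀a , same with edge-in-triangle u₀a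
  ...   | t , △@(_ , at , u₀t)
      with TriangleColouring.hit (triangleColouring △) (TriangleColouring.colour (triangleColouring △) v₀)
  ...     | w , (u₀w , aw , tw) , same′ =
    a , w , (u₀a , aw , u₀w) , (a≢v₀ , v₀≁a) , ((λ { refl → u₀≁v₀ u₀w }) , v₀≁w)
    where
    a≢v₀ : a ≢ v₀
    a≢v₀ refl = u₀≁v₀ u₀a
    v₀≁a : ¬ v₀ ~ a
    v₀≁a v₀a = VertexColouring.proper (vertexColouring u₀)
      (λ e → u₀≢v₀ (≡-sym e)) (λ { refl → ~-irrefl G u₀a refl }) v₀a (≡-sym same)
    v₀≁w : ¬ v₀ ~ w
    v₀≁w v₀w = TriangleColouring.proper (triangleColouring △)
      ((λ e → u₀≢v₀ (≡-sym e)) , (λ { refl → u₀≁v₀ u₀a }) , (λ { refl → u₀≁v₀ u₀t }))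
      ((λ { refl → ~-irrefl G u₀w refl }) , (λ { refl → ~-irrefl G aw refl }) , (λ { refl → ~-irrefl G tw refl }))
      v₀w (≡-sym same′)

  deg-v₀-≤16 : deg v₀ ≤ 16
  deg-v₀-≤16 with triangle-far-from-v₀
  ... | a , w , △ , (a≢v₀ , v₀≁a) , (w≢v₀ , v₀≁w) = begin
    deg v₀            ≤⟨ count-by-classes colour (adj? G v₀) other? other
                           (colour-class-≤2 colour (adj? G v₀) (λ v₀x → v₀x)
                             (λ v₀x v₀y → proper (off v₀x) (off v₀y))) ⟩
    count other? * 2  ≤⟨ *-monoˡ-≤ 2 (+-cancelʳ-≤ 1 _ 8 others) ⟩
    16                ∎
    where
    open ≤-Reasoning
    open TriangleColouring (triangleColouring △)
    any-colour? : Decidable {A = Fin 9} (λ _ → ⊤)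
    any-colour? _ = yes tt
    other? : Decidable (λ j → ⊤ × j ≢ colour v₀)
    other? = any-colour? without colour v₀
    others : count other? + 1 ≤ 9
    others = ≤-trans (count-without-< any-colour? {colour v₀} tt) (≤-reflexive (count-all any-colour? (λ _ → tt)))
    off : ∀ {x} → v₀ ~ x → x ≢ u₀ × x ≢ a × x ≢ w
    off v₀x = (λ { refl → u₀≁v₀ (~-sym G v₀x) }) , (λ { refl → v₀≁a v₀x }) , (λ { refl → v₀≁w v₀x })
    other : ∀ {x} → v₀ ~ x → ⊤ × colour x ≢ colour v₀
    other v₀x = tt , λ same → proper ((λ e → u₀≢v₀ (≡-sym e)) , (λ e → a≢v₀ (≡-sym e)) , (λ e → w≢v₀ (≡-sym e)))
      (off v₀x) v₀x (≡-sym same)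

  -- Double counting of common anti-neighbours

  module _ {v y : Fin n} (act : Active v y) where

    -- By `¬anti`, these are the active vertices adjacent to `y`.
    Rest : Fin n → Set
    Rest z = (Active v z × z ≢ y) × ¬ Anti v y z

    rest? : Decidable Rest
    rest? z = (active? v z ×-dec ¬? (z ≟ y)) ×-dec ¬? (anti? v y z)

    -- N(v) splits into the isolated vertices, `y`, its anti-neighbours and `Rest`; `isolated-bound`
    -- then trades the isolated vertices for 20 - deg v.
    rest-many : deg v + deg v ≤ count rest? + antideg v y + 21
    rest-many = begin
      deg v + deg v ≤⟨ +-monoˡ-≤ (deg v) deg-≤ ⟩
      i + (q + r + 1) + deg v ≡⟨ cong (_+ deg v) (+-comm i (q + r + 1)) ⟩
      q + r + 1 + i + deg v ≡⟨ +-assoc (q + r + 1) i (deg v) ⟩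
      q + r + 1 + (i + deg v) ≤⟨ +-monoʳ-≤ (q + r + 1) isolated-≤ ⟩
      q + r + 1 + 20 ≡⟨ +-assoc (q + r) 1 20 ⟩
      q + r + 21 ∎
      where
      open ≤-Reasoning
      q = count rest?
      r = antideg v y
      i = count (isolated? v)
      isolated-≤ : i + deg v ≤ 20
      isolated-≤ = let (_ , △ , actt , _) = active-triangle act in isolated-bound △ act actt
      split : ∀ {x} → Active v x × x ≢ y → Rest x ⊎ Anti v y x
      split {x} ax with anti? v y x
      ... | yes y⊥x = inj₂ y⊥x
      ... | no ¬y⊥x = inj₁ (ax , ¬y⊥x)
      deg-≤ : deg v ≤ i + (q + r + 1)
      deg-≤ = begin
        deg v ≤⟨ count-cover (isolated? v) (active? v) (adj? G v) isolated-or-active ⟩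
        i + count (active? v) ≤⟨ +-monoʳ-≤ i (count-without-≥ (active? v) y) ⟩
        i + (count (active? v without y) + 1) ≤⟨ +-monoʳ-≤ i (+-monoˡ-≤ 1
                                                  (count-cover rest? (anti? v y) (active? v without y) split)) ⟩
        i + (q + r + 1) ∎

    common? : ∀ z → Decidable (λ x → Rest z × Anti v y x × Anti v z x)
    common? z x = rest? z ×-dec anti? v y x ×-dec anti? v z x

    -- Inclusion-exclusion on the anti-neighbourhoods of `y` and `z`: that of `z` has size at least
    -- 3, and the union has size at most deg v - 11, whence 14 = 3 + 11.
    rest-common : ∀ {z} → Rest z → antideg v y + 14 ≤ deg v + count (common? z)
    rest-common {z} Rz@((actz , z≢y) , ¬y⊥z) = begin
      antideg v y + 14                                    ≡⟨ +-assoc (antideg v y) 3 11 ⟨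
      antideg v y + 3 + 11                                ≤⟨ +-monoˡ-≤ 11 (+-monoʳ-≤ (antideg v y) (active-≥3 actz)) ⟩
      antideg v y + antideg v z + 11                      ≤⟨ +-monoˡ-≤ 11 (count-modular (anti? v y) (anti? v z) U? (common? z)
                                                                           inj₁ inj₂ (λ y⊥x z⊥x → Rz , y⊥x , z⊥x)) ⟩
      count U? + count (common? z) + 11                   ≡⟨ +-assoc (count U?) _ 11 ⟩
      count U? + (count (common? z) + 11)                 ≡⟨ cong (count U? +_) (+-comm _ 11) ⟩
      count U? + (11 + count (common? z))                 ≡⟨ +-assoc (count U?) 11 _ ⟨
      count U? + 11 + count (common? z)                   ≤⟨ +-monoˡ-≤ _ (anti-union-≤ △) ⟩
      deg v + count (common? z)                           ∎
      where
      open ≤-Reasoning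
      U? = anti-union? v y z
      △ : IsTriangle G v y z
      △ = active-adj act , ¬anti (active-adj act) (active-adj actz) (λ e → z≢y (≡-sym e)) ¬y⊥z , active-adj actz

    incidences : ∀ {t Δ} → antideg v y + 14 ≡ deg v + t → (∀ x → antideg v x ≤ suc Δ) →
      count rest? * t ≤ antideg v y * Δ
    incidences {t} {Δ} t-def max = double-count rest? (anti? v y) common?
      (λ z Rz → +-cancelˡ-≤ (deg v) _ _ (≤-trans (≤-reflexive (≡-sym t-def)) (rest-common Rz)))
      upper (λ (_ , y⊥x , _) → y⊥x)
      where
      -- `y` is itself an anti-neighbour of `x` but is excluded from `Rest`, which lowers the
      -- maximum by one.
      upper : ∀ x → Anti v y x → count (λ z → common? z x) ≤ Δ
      upper x y⊥x = +-cancelʳ-≤ 1 _ _ (begin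
        count (λ z → common? z x) + 1     ≤⟨ +-monoˡ-≤ 1 (count-⊆ (λ z → common? z x) (anti? v x without y)
                                               (λ (((_ , z≢y) , _) , _ , z⊥x) → anti-sym z⊥x , z≢y)) ⟩
        count (anti? v x without y) + 1   ≤⟨ count-without-< (anti? v x) (anti-sym y⊥x) ⟩
        antideg v x                       ≤⟨ max x ⟩
        suc Δ                             ≡⟨ +-comm 1 Δ ⟩
        Δ + 1                             ∎)
        where open ≤-Reasoning

  antideg-≤ : ∀ {v} x → 12 ≤ deg v → antideg v x + 12 ≤ deg v
  antideg-≤ {v} x 12≤ = bound (active? v x)
    where
    bound : Dec (Active v x) → antideg v x + 12 ≤ deg v
    bound (yes act) = proj₂ (proj₂ (proj₂ (active-triangle act)))
    bound (no ¬act) = ≤-trans (≤-reflexive (cong (_+ 12) (count-none (anti? v x) (λ y x⊥y → ¬act (y , x⊥y))))) 12≤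

  -- Otherwise N(v) would be a clique on at least 11 vertices.
  some-active : ∀ v → ∃ (Active v)
  some-active v = decidable-stable (any? (active? v)) λ none → contradiction
    (local-clique-≤10 (adj? G v) (λ vx → vx) (λ vx vy x≢y → ¬anti vx vy x≢y λ x⊥y → none (_ , _ , x⊥y)))
    (<⇒≱ (deg-≥11 v))

  no-maximum : ∀ {v y} → deg v ≤ 16 → Active v y → (∀ x → antideg v x ≤ antideg v y) → ⊥
  no-maximum {v} {y} d≤16 act max =
    too-many-incidences (active-≥3 act) (proj₂ (proj₂ (proj₂ (active-triangle act)))) d≤16 (rest-many act)
      (λ t-def r≡1+Δ → incidences act t-def (λ x → ≤-trans (max x) (≤-reflexive r≡1+Δ)))

  impossible : ⊥
  impossible = maximum (any? (λ x → 4 ≤? antideg v₀ x))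
    where
    y = proj₁ (some-active v₀)
    act = proj₂ (some-active v₀)
    15≤ : 15 ≤ deg v₀
    15≤ = ≤-trans (+-monoˡ-≤ 12 (active-≥3 act)) (proj₂ (proj₂ (proj₂ (active-triangle act))))
    ≤4 : ∀ x → antideg v₀ x ≤ 4
    ≤4 x = +-cancelʳ-≤ 12 _ 4 (≤-trans (antideg-≤ x (≤-trans (m≤m+n 12 3) 15≤)) deg-v₀-≤16)
    -- Positive anti-degrees at `v₀` are 3 or 4, since 4 = 16 - 12. Hence a vertex attaining 4 is a
    -- maximum, and if there is none, every active vertex is one.
    maximum : Dec (∃[ x ] 4 ≤ antideg v₀ x) → ⊥
    maximum (yes (x , 4≤)) = no-maximum deg-v₀-≤16
      (count-witness (anti? v₀ x) (≤-trans (s≤s z≤n) 4≤)) (λ w → ≤-trans (≤4 w) 4≤)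
    maximum (no ¬4≤) = no-maximum deg-v₀-≤16 act
      (λ w → ≤-trans (≮⇒≥ (λ 3< → ¬4≤ (w , 3<))) (active-≥3 act))

-- Colourings of complete graphs and the conclusion

complete-count : ∀ {n} (G : Graph n) → Complete G → ∀ {k} → ColourableOn G allV k → n ≤ k
complete-count {n} G complete {k} (c , proper) = injective⇒≤ {f = λ v → c v tt}
  (λ {u} {v} cu≡cv → decidable-stable (u ≟ v) λ u≢v → proper u v tt tt (complete u v u≢v) cu≡cv)

trivially-colourable : ∀ {n} (G : Graph n) → ColourableOn G allV n
trivially-colourable G = (λ v _ → v) , λ u v _ _ → ~-irrefl G

theorem8 : ∀ {n : ℕ} (G : Graph n) → TriangleCritical G → ClawFree G → Chi G 12 → Complete G × n ≡ 12
theorem8 {n} G (_ , critical , triangleCritical) clawFree χ@(col12 , minimal) =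
  -- A 12-colouring of a complete graph is injective, so n ≤ 12; with n < 12, giving each vertex its
  -- own colour would contradict minimality.
  complete , ≤-antisym (complete-count G complete col12) (≮⇒≥ λ n<12 → minimal n n<12 (trivially-colourable G))
  where
  ¬col11 : ¬ ColourableOn G allV 11
  ¬col11 = minimal 11 ≤-refl
  complete : Complete G
  complete u v u≢v = decidable-stable (adj? G u v) λ u≁v →
    NonComplete.impossible G clawFree
      -- Eleven colours arise as 12 - 1 for a vertex, and as 9 + 2 with 9 = 12 - 3 for a triangle,
      -- so `¬col11` serves both.
      (λ x → vertex-colouring G ¬col11 (proj₁ (critical 12 χ x)))
      (λ {p} {q} {r} △ → triangle-colouring G ¬col11 (proj₁ (triangleCritical 12 χ p q r △)))
      u v u≢v u≁v
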